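{- Let $n\ge 1$, let $p_1,p_2,\dots,p_n$ be distinct primes, and let $a_1,a_2,\dots,a_n\in\mathbb{N}$. Assume that $\gcd(a_i,\,p_1p_2\cdots p_n)=p_i$ for every $1\le i\le n$. Then $$a_1^{L}+a_2^{L}+\cdots+a_n^{L}\equiv n-1 \pmod{p_1p_2\cdots p_n}$$ for every integer $L>0$ such that $\operatorname{lcm}(p_1-1,p_2-1,\dots,p_n-1)$ divides $L$.
   Context: $\mathbb{N}$ denotes the set of positive integers. -}

module Defs where

open import Data.Integer.Base as ℤ using (ℤ; +_)
import Data.Integer.Divisibility.Signed as ℤ
open import Data.Nat.Base using (ℕ; _+_; _*_)
import Data.Nat.LCM as ℕ
open import Data.Vec.Functional using (Vector; foldr)

infix 4 _≡_[mod_]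

_≡_[mod_] : ℤ → ℤ → ℕ → Set
x ≡ y [mod m ] = (+ m) ℤ.∣ (x ℤ.- y)

sum : ∀ {n} → Vector ℕ n → ℕ
sum = foldr _+_ 0

product : ∀ {n} → Vector ℕ n → ℕ
product = foldr _*_ 1

-- The unit 1 is neutral for lcm, so the lcm of a one-element family is its element.
lcm : ∀ {n} → Vector ℕ n → ℕ
lcm = foldr ℕ.lcm 1

{-# OPTIONS --safe #-}
-- Modulo p_i the term a_i^L vanishes, since p_i ∣ a_i and L > 0, while every other
-- a_j is prime to p_i (otherwise p_i ∣ gcd(a_j, p_1⋯p_n) = p_j), so that a_j^L ≡ 1
-- by Fermat's little theorem.  The sum is therefore n − 1 modulo each p_i, hence
-- modulo their product.
module Submission where

open import Defs
open import Data.Integer.Base as ℤ using (+_)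
import Data.Integer.Divisibility.Signed as ℤ
import Data.Integer.Properties as ℤ
open import Data.Integer.Tactic.RingSolver using (solve-∀)
open import Data.Fin.Base using (zero; suc; toℕ; inject₁)
open import Data.Fin.Properties
  using (toℕ-fromℕ; toℕ-inject₁; toℕ<n; punchInᵢ≢i; suc-injective)
open import Data.Nat.Base
  using (ℕ; zero; suc; _≥_; _>_; _<_; _≤_; z<s; s<s; _∸_; _^_; _+_; _*_; _!; NonZero;
         +-0-rawMonoid)
open import Data.Nat.Combinatorics using (_C_; nCn≡1; nCk≡n!/k![n-k]!; k![n∸k]!∣n!)
open import Data.Nat.Divisibility
  using (_∣_; _∤_; divides; ∣-trans; _∣0; ∣1⇒≡1; ∣⇒≤; ∣m∣n⇒∣m+n; ∣m⇒∣m*n;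
         m∣m*n; n∣m*n; *-monoˡ-∣)
open import Data.Nat.DivMod using (m*[n/m]≡n)
open import Data.Nat.GCD using (gcd; gcd-greatest; gcd[m,n]∣m)
open import Data.Nat.LCM using (m∣lcm[m,n]; n∣lcm[m,n])
import Data.Nat.Properties as ℕ
open import Data.Nat.Primality
  using (Prime; euclidsLemma; prime⇒irreducible; prime⇒nonZero; ¬prime[0]; ¬prime[1])
open import Data.Product.Base using (∃; _,_)
open import Data.Sum.Base using (_⊎_; inj₁; inj₂)
open import Data.Vec.Functional using (Vector; head; tail; init; last; removeAt)
open import Function.Base using (_∘_)
open import Function.Definitions using (Injective)
open import Relation.Binary.PropositionalEquality
  using (_≡_; _≢_; refl; sym; trans; cong; cong₂; subst; subst₂; module ≡-Reasoning)
open import Relation.Nullary using (contradiction)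
open import Algebra.Properties.CommutativeMonoid.Sum ℕ.+-0-commutativeMonoid
  using (sum-init-last; sum-remove)
import Algebra.Properties.CommutativeSemiring.Binomial ℕ.+-*-commutativeSemiring as Binomial
import Algebra.Properties.Semiring.Exp ℕ.+-*-semiring as Exp
open import Algebra.Definitions.RawMonoid +-0-rawMonoid using (_×_)

private
  variable
    m n p : ℕ
    a b c d : ℕ

infix 4 _≅_[mod_]

-- A record, so that a, b and m can be inferred from a proof of the congruence.
record _≅_[mod_] (a b m : ℕ) : Set where
  constructor congruent
  field difference : + a ≡ + b [mod m ]

open _≅_[mod_]

≅-refl : a ≅ a [mod m ]
≅-refl {a} = congruent (ℤ.divides (+ 0) (ℤ.+-inverseʳ (+ a)))

≅-trans : a ≅ b [mod m ] → b ≅ c [mod m ] → a ≅ c [mod m ]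
≅-trans {a} {b} {m} {c} (congruent a≅b) (congruent b≅c) =
  congruent (subst (+ m ℤ.∣_) (lemma (+ a) (+ b) (+ c)) (ℤ.∣m∣n⇒∣m+n a≅b b≅c))
  where
  lemma : ∀ x y z → (x ℤ.- y) ℤ.+ (y ℤ.- z) ≡ x ℤ.- z
  lemma = solve-∀

+-cong-≅ : a ≅ b [mod m ] → c ≅ d [mod m ] → a + c ≅ b + d [mod m ]
+-cong-≅ {a} {b} {m} {c} {d} (congruent a≅b) (congruent c≅d) =
  congruent (subst (+ m ℤ.∣_) (lemma (+ a) (+ b) (+ c) (+ d)) (ℤ.∣m∣n⇒∣m+n a≅b c≅d))
  where
  lemma : ∀ x y u v → (x ℤ.- y) ℤ.+ (u ℤ.- v) ≡ (x ℤ.+ u) ℤ.- (y ℤ.+ v)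
  lemma = solve-∀

*-cong-≅ : a ≅ b [mod m ] → c ≅ d [mod m ] → a * c ≅ b * d [mod m ]
*-cong-≅ {a} {b} {m} {c} {d} (congruent a≅b) (congruent c≅d) =
  congruent (subst (+ m ℤ.∣_)
    (trans (lemma (+ a) (+ b) (+ c) (+ d))
           (sym (cong₂ ℤ._-_ (ℤ.pos-* a c) (ℤ.pos-* b d))))
    (ℤ.∣m∣n⇒∣m+n (ℤ.∣m⇒∣m*n (+ c) a≅b) (ℤ.∣n⇒∣m*n (+ b) c≅d)))
  where
  lemma : ∀ x y u v → (x ℤ.- y) ℤ.* u ℤ.+ y ℤ.* (u ℤ.- v) ≡ x ℤ.* u ℤ.- y ℤ.* v
  lemma = solve-∀

∣⇒≅0 : m ∣ a → a ≅ 0 [mod m ]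
∣⇒≅0 {m} {a} m∣a =
  congruent (subst (+ m ℤ.∣_) (sym (ℤ.+-identityʳ (+ a))) (ℤ.∣ᵤ⇒∣ {+ m} {+ a} m∣a))

^-≅1 : ∀ k → a ≅ 1 [mod m ] → a ^ k ≅ 1 [mod m ]
^-≅1 zero    a≅1 = ≅-refl
^-≅1 (suc k) a≅1 = *-cong-≅ a≅1 (^-≅1 k a≅1)

sum-≅n : (b : Vector ℕ n) → (∀ i → b i ≅ 1 [mod m ]) → sum b ≅ n [mod m ]
sum-≅n {zero}  b b≅1 = ≅-refl
sum-≅n {suc n} b b≅1 = +-cong-≅ (b≅1 zero) (sum-≅n (tail b) (b≅1 ∘ suc))

∣-sum : (b : Vector ℕ n) → (∀ i → m ∣ b i) → m ∣ sum b
∣-sum {zero}  {m} b m∣b = m ∣0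
∣-sum {suc n} b m∣b = ∣m∣n⇒∣m+n (m∣b zero) (∣-sum (tail b) (m∣b ∘ suc))

∣-product : (b : Vector ℕ n) → ∀ i → b i ∣ product b
∣-product b zero    = m∣m*n _
∣-product b (suc i) = ∣-trans (∣-product (tail b) i) (n∣m*n (head b))

∣-lcm : (b : Vector ℕ n) → ∀ i → b i ∣ lcm b
∣-lcm b zero    = m∣lcm[m,n] (head b) _
∣-lcm b (suc i) = ∣-trans (∣-lcm (tail b) i) (n∣lcm[m,n] (head b) _)

∣-^ : ∀ {k} → k > 0 → m ∣ a → m ∣ a ^ k
∣-^ {k = suc k} _ m∣a = ∣m⇒∣m*n _ m∣a

prime∤1 : Prime p → p ∤ 1
prime∤1 p-prime p∣1 = ¬prime[1] (subst Prime (∣1⇒≡1 p∣1) p-prime)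

prime∣prime⇒≡ : ∀ {q} → Prime p → Prime q → p ∣ q → p ≡ q
prime∣prime⇒≡ p-prime q-prime p∣q with prime⇒irreducible q-prime p∣q
... | inj₁ refl = contradiction p-prime ¬prime[1]
... | inj₂ p≡q  = p≡q

prime∣product : Prime p → (b : Vector ℕ n) → p ∣ product b → ∃ λ i → p ∣ b i
prime∣product {n = zero}  p-prime b p∣1 = contradiction p∣1 (prime∤1 p-prime)
prime∣product {n = suc n} p-prime b p∣b with euclidsLemma (head b) _ p-prime p∣b
... | inj₁ p∣head = zero , p∣head
... | inj₂ p∣tail with prime∣product p-prime (tail b) p∣tail
...   | i , p∣bᵢ = suc i , p∣bᵢ

product-∣ : (p : Vector ℕ n) → (∀ i → Prime (p i)) → Injective _≡_ _≡_ p →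
            (∀ i → p i ∣ m) → product p ∣ m
product-∣ {zero}  {m} p p-prime inj p∣m = divides m (sym (ℕ.*-identityʳ m))
product-∣ {suc n} p p-prime inj p∣m
  with product-∣ (tail p) (p-prime ∘ suc) (suc-injective ∘ inj) (p∣m ∘ suc)
... | divides q refl with euclidsLemma q (product (tail p)) (p-prime zero) (p∣m zero)
...   | inj₁ p₀∣q = *-monoˡ-∣ (product (tail p)) p₀∣q
...   | inj₂ p₀∣rest with prime∣product (p-prime zero) (tail p) p₀∣rest
...     | i , p₀∣pᵢ with inj (prime∣prime⇒≡ (p-prime zero) (p-prime (suc i)) p₀∣pᵢ)
...       | ()

prime∤! : Prime p → ∀ {k} → k < p → p ∤ k !
prime∤! p-prime {zero}  _     p∣1 = prime∤1 p-prime p∣1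
prime∤! p-prime {suc k} k+1<p p∣! with euclidsLemma (suc k) (k !) p-prime p∣!
... | inj₁ p∣k+1 = contradiction (∣⇒≤ p∣k+1) (ℕ.<⇒≱ k+1<p)
... | inj₂ p∣k!  = prime∤! p-prime (ℕ.<-trans (ℕ.n<1+n k) k+1<p) p∣k!

n∣n! : .{{NonZero n}} → n ∣ n !
n∣n! {suc n} = m∣m*n (n !)

k![n∸k]!*nCk≡n! : ∀ {k} → k ≤ n → k ! * (n ∸ k) ! * (n C k) ≡ n !
k![n∸k]!*nCk≡n! {n} {k} k≤n =
  trans (cong (k ! * (n ∸ k) ! *_) (nCk≡n!/k![n-k]! k≤n)) (m*[n/m]≡n (k![n∸k]!∣n! k≤n))
  where instance _ = k ℕ.!* (n ∸ k) !≢0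

prime∣C : Prime p → ∀ {k} → 0 < k → k < p → p ∣ p C k
prime∣C {p} p-prime {k} 0<k k<p
  with euclidsLemma (k ! * (p ∸ k) !) (p C k) p-prime
         (subst (p ∣_) (sym (k![n∸k]!*nCk≡n! (ℕ.<⇒≤ k<p))) (n∣n! {{prime⇒nonZero p-prime}}))
... | inj₂ p∣C = p∣C
... | inj₁ p∣d with euclidsLemma (k !) ((p ∸ k) !) p-prime p∣d
...   | inj₁ p∣k!     = contradiction p∣k! (prime∤! p-prime k<p)
...   | inj₂ p∣[p-k]! =
        contradiction p∣[p-k]! (prime∤! p-prime (ℕ.∸-monoʳ-< 0<k (ℕ.<⇒≤ k<p)))

×≡* : ∀ k b → k × b ≡ k * b
×≡* zero    b = refl
×≡* (suc k) b = cong (λ t → b + t) (×≡* k b)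

^≡^ : ∀ a k → a Exp.^ k ≡ a ^ k
^≡^ a zero    = refl
^≡^ a (suc k) = cong (a *_) (^≡^ a k)

freshman's-dream : Prime p → ∀ a b → (a + b) ^ p ≅ a ^ p + b ^ p [mod p ]
freshman's-dream {zero}      p-prime a b = contradiction p-prime ¬prime[0]
freshman's-dream {p@(suc q)} p-prime a b =
  subst₂ (_≅_[mod p ]) (sym expansion) (ℕ.+-comm (b ^ p) (a ^ p))
    (+-cong-≅ (≅-refl {b ^ p})
      (+-cong-≅ (∣⇒≅0 (∣-sum middle p∣middle)) (≅-refl {a ^ p})))
  where
  term : Vector ℕ (suc p)
  term = Binomial.binomialTerm a b p

  middle : Vector ℕ q
  middle = init (tail term)

  p∣middle : ∀ i → p ∣ middle i
  p∣middle i = subst (p ∣_) (sym (×≡* (p C suc (toℕ (inject₁ i))) _))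
    (∣m⇒∣m*n _ (prime∣C p-prime z<s (s<s (subst (_< q) (sym (toℕ-inject₁ i)) (toℕ<n i)))))

  first≡ : head term ≡ b ^ p
  first≡ = trans (ℕ.+-identityʳ _) (trans (ℕ.+-identityʳ _) (^≡^ b p))

  last≡ : last term ≡ a ^ p
  last≡ rewrite toℕ-fromℕ q | nCn≡1 p | ℕ.n∸n≡0 q =
    trans (ℕ.+-identityʳ _) (trans (ℕ.*-identityʳ _) (^≡^ a p))

  expansion : (a + b) ^ p ≡ b ^ p + (sum middle + a ^ p)
  expansion = begin
    (a + b) ^ p                          ≡⟨ ^≡^ (a + b) p ⟨
    (a + b) Exp.^ p                      ≡⟨ Binomial.theorem p a b ⟩
    head term + sum (tail term)          ≡⟨ cong (λ t → head term + t) (sum-init-last (tail term)) ⟩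
    head term + (sum middle + last term) ≡⟨ cong₂ (λ s t → s + (sum middle + t)) first≡ last≡ ⟩
    b ^ p + (sum middle + a ^ p)         ∎
    where open ≡-Reasoning

a^p≅a : Prime p → ∀ a → a ^ p ≅ a [mod p ]
a^p≅a {zero}  p-prime a       = contradiction p-prime ¬prime[0]
a^p≅a {suc q} p-prime zero    = ≅-refl
a^p≅a {suc q} p-prime (suc a) = ≅-trans (freshman's-dream p-prime 1 a)
  (+-cong-≅ (^-≅1 (suc q) ≅-refl) (a^p≅a p-prime a))

fermat : Prime p → p ∤ a → a ^ (p ∸ 1) ≅ 1 [mod p ]
fermat {zero}          p-prime p∤a = contradiction p-prime ¬prime[0]
fermat {p@(suc q)} {a} p-prime p∤a = cancel (euclidsLemma a ℤ.∣ + (a ^ q) ℤ.- + 1 ∣ p-prime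
    (subst (p ∣_) (ℤ.abs-* (+ a) (+ (a ^ q) ℤ.- + 1)) (ℤ.∣⇒∣ᵤ p∣a[a^q-1])))
  where
  lemma : ∀ x y → x ℤ.* y ℤ.- x ≡ x ℤ.* (y ℤ.- + 1)
  lemma = solve-∀

  p∣a[a^q-1] : + p ℤ.∣ + a ℤ.* (+ (a ^ q) ℤ.- + 1)
  p∣a[a^q-1] = subst (+ p ℤ.∣_)
    (trans (cong (ℤ._- + a) (ℤ.pos-* a (a ^ q))) (lemma (+ a) (+ (a ^ q))))
    (difference (a^p≅a p-prime a))

  cancel : p ∣ a ⊎ p ∣ ℤ.∣ + (a ^ q) ℤ.- + 1 ∣ → a ^ q ≅ 1 [mod p ]
  cancel (inj₁ p∣a)     = contradiction p∣a p∤a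
  cancel (inj₂ p∣a^q-1) = congruent (ℤ.∣ᵤ⇒∣ p∣a^q-1)

fermat-multiple : Prime p → ∀ {k} → p ∤ a → p ∸ 1 ∣ k → a ^ k ≅ 1 [mod p ]
fermat-multiple {p} {a} p-prime p∤a (divides q refl) =
  subst (_≅ 1 [mod p ])
    (trans (ℕ.^-*-assoc a (p ∸ 1) q) (cong (a ^_) (ℕ.*-comm (p ∸ 1) q)))
    (^-≅1 q (fermat p-prime p∤a))

theorem4 : (n : ℕ) → n ≥ 1 →
    (p : Vector ℕ n) → (∀ i → Prime (p i)) → Injective _≡_ _≡_ p →
    (a : Vector ℕ n) → (∀ i → a i > 0) →
    (∀ i → gcd (a i) (product p) ≡ p i) →
    (L : ℕ) → L > 0 → lcm (λ i → p i ∸ 1) ∣ L →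
    (+ (sum (λ i → a i ^ L))) ≡ (+ n ℤ.- + 1) [mod product p ]
theorem4 (suc n) _ p p-prime inj a _ gcd≡p L L>0 lcm∣L =
  ℤ.∣ᵤ⇒∣ (product-∣ p p-prime inj (λ i → ℤ.∣⇒∣ᵤ (difference (sum≅n i))))
  where
  aᴸ : Vector ℕ (suc n)
  aᴸ i = a i ^ L

  p∣a : ∀ i → p i ∣ a i
  p∣a i = subst (_∣ a i) (gcd≡p i) (gcd[m,n]∣m (a i) (product p))

  p∤a : ∀ {i j} → j ≢ i → p i ∤ a j
  p∤a {i} {j} j≢i pᵢ∣aⱼ = j≢i (sym (inj (prime∣prime⇒≡ (p-prime i) (p-prime j)
    (subst (p i ∣_) (gcd≡p j) (gcd-greatest pᵢ∣aⱼ (∣-product p i))))))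

  aᴸ≅1 : ∀ {i j} → j ≢ i → aᴸ j ≅ 1 [mod p i ]
  aᴸ≅1 {i} j≢i =
    fermat-multiple (p-prime i) (p∤a j≢i) (∣-trans (∣-lcm (λ i → p i ∸ 1) i) lcm∣L)

  sum≅n : ∀ i → sum aᴸ ≅ n [mod p i ]
  sum≅n i = subst (_≅ n [mod p i ]) (sym (sum-remove {i = i} aᴸ))
    (+-cong-≅ (∣⇒≅0 (∣-^ L>0 (p∣a i)))
      (sum-≅n (removeAt aᴸ i) (λ j → aᴸ≅1 (punchInᵢ≢i i j))))
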